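{- Let $G$ be a finite simple undirected graph with $n$ nodes, maximum degree $\Delta$ and no isolated nodes, in which every node has even degree, and let $\tau$ be the strict majority threshold assignment of $G$. Then $$\overleftrightarrow{MTT}(G,\tau)\ge\frac{4n}{\Delta+2}.$$ Moreover this bound is tight, i.e., there are such graphs $G$ for which equality holds.
   Context: For a graph $G=(V,E)$, $N(v)$ is the set of neighbors of $v$ and $d(v)=|N(v)|$. A threshold assignment is a function $\tau:V\to\mathbb{N}\cup\{0\}$ with $0\le\tau(v)\le d(v)$ for all $v$. The strict majority threshold assignment is $\tau(v)=\lceil (d(v)+1)/2\rceil$. A finite sequence $\mathcal{S}_0,\ldots,\mathcal{S}_k$ of subsets of $V$ (for some integer $k$) is a timed target set (TTS) of $(G,\tau)$ (in the non-progressive model) if there is a sequence $Q_0,\ldots,Q_k$ of subsets of $V$ such that (i) $Q_0=\emptyset$; (ii) for $i\ge1$, $v\in Q_i$ if and only if $|N(v)\cap(\mathcal{S}_{i-1}\cup Q_{i-1})|\ge\tau(v)$; (iii) $\mathcal{S}_k=\emptyset$; (iv) $Q_k=V$. Its size is $\sum_{i=0}^k|\mathcal{S}_i|$, and $\overleftrightarrow{MTT}(G,\tau)$ is the minimum size of a TTS of $(G,\tau)$. -}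

module Defs where

open import Data.Bool.Properties using () renaming (_≟_ to _≟ᵇ_)
open import Data.Fin using (Fin; zero; suc; inject₁; fromℕ)
open import Data.Fin.Subset using (Subset; inside; outside; _∈_; _∩_; _∪_; ∣_∣; ⊥; ⊤)
open import Data.Fin.Subset.Properties
  using (⊆-antisym; anySubset?; ∈⊤; ∣⊥∣≡0; ∪-identityʳ; ∩-identityʳ)
open import Data.List using (List; []; _∷_; _++_; map)
open import Data.List.Membership.Propositional using () renaming (_∈_ to _∈ˡ_)
open import Data.List.Membership.Propositional.Properties using (∈-map⁺; ∈-++⁺ˡ; ∈-++⁺ʳ)
open import Data.List.Relation.Unary.Any using (here; there)
open import Data.Nat
open import Data.Nat.Divisibility using (_∣_)
open import Data.Nat.Properties
open import Data.Product using (∃; ∃₂; _×_; _,_; proj₁; proj₂)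
open import Data.Sum using (_⊎_; inj₁; inj₂)
open import Data.Vec using (tabulate; []; _∷_)
open import Data.Vec.Properties
  using (≡-dec; lookup∘tabulate; []=⇒lookup; lookup⇒[]=)
open import Data.Vec.Functional as Vector using (Vector)
open import Function.Base using (_∘_)
open import Function.Bundles using (_⇔_; mk⇔; Equivalence)
open import Level using (0ℓ)
open import Relation.Binary using (Rel; Irreflexive; Symmetric; DecidableEquality)
  renaming (Decidable to Decidable₂)
open import Relation.Binary.PropositionalEquality
open import Relation.Nullary using (yes; no; does)
open import Relation.Nullary.Decidable using (_×-dec_; _⊎-dec_; dec-true)
open import Relation.Unary using (Pred; Decidable)

open import Algebra.Properties.CommutativeMonoid.Sum +-0-commutativeMonoid using (sum)

record Graph (n : ℕ) : Set₁ where
  field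
    Adj        : Rel (Fin n) 0ℓ
    adj?       : Decidable₂ Adj
    adj-sym    : Symmetric Adj
    adj-irrefl : Irreflexive _≡_ Adj

comprehension : ∀ {n} {P : Pred (Fin n) 0ℓ} → Decidable P → Subset n
comprehension P? = tabulate (does ∘ P?)

∈-comprehension : ∀ {n} {P : Pred (Fin n) 0ℓ} (P? : Decidable P) {v} →
                  v ∈ comprehension P? ⇔ P v
∈-comprehension {P = P} P? {v} = mk⇔ to from
  where
  to : v ∈ comprehension P? → P v
  to v∈ with P? v | trans (sym (lookup∘tabulate (does ∘ P?) v)) ([]=⇒lookup v∈)
  ... | yes p | _ = p
  ... | no _  | ()
  from : P v → v ∈ comprehension P?
  from p = lookup⇒[]= v _ (trans (lookup∘tabulate (does ∘ P?) v) (dec-true (P? v) p))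

module _ {n : ℕ} (G : Graph n) where
  open Graph G

  neighbours : Fin n → Subset n
  neighbours v = comprehension (adj? v)

  degree : Fin n → ℕ
  degree v = ∣ neighbours v ∣

  -- This is 0 for the graph without nodes.
  maxDegree : ℕ
  maxDegree = Vector.foldr _⊔_ 0 degree

  NoIsolatedNodes : Set
  NoIsolatedNodes = ∀ v → 0 < degree v

  EvenDegrees : Set
  EvenDegrees = ∀ v → 2 ∣ degree v

  record ThresholdAssignment : Set where
    field
      τ        : Fin n → ℕ
      τ≤degree : ∀ v → τ v ≤ degree v

  strictMajority : NoIsolatedNodes → ThresholdAssignment
  strictMajority noIsolated = record
    { τ        = λ v → ⌈ degree v + 1 /2⌉
    ; τ≤degree = λ v → bound (noIsolated v)
    }
    where
    bound : ∀ {d} → 0 < d → ⌈ d + 1 /2⌉ ≤ d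
    bound {suc d} _ rewrite +-comm d 1 = s≤s (⌈n/2⌉≤n d)

IsLeast : Pred ℕ 0ℓ → Pred ℕ 0ℓ
IsLeast P m = P m × (∀ {s} → P s → m ≤ s)

least : {P : Pred ℕ 0ℓ} → Decidable P → ∃ P → ∃ (IsLeast P)
least {P} P? (m , Pm) = search m 0 (λ _ → z≤n) (subst P (sym (+-identityʳ m)) Pm)
  where
  search : ∀ fuel lo → (∀ {s} → P s → lo ≤ s) → P (fuel + lo) → ∃ (IsLeast P)
  search zero       lo bound Plo = lo , Plo , bound
  search (suc fuel) lo bound Phi with P? lo
  ... | yes Plo = lo , Plo , bound
  ... | no ¬Plo = search fuel (suc lo)
    (λ {s} Ps → ≤∧≢⇒< (bound Ps) (λ lo≡s → ¬Plo (subst P (sym lo≡s) Ps)))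
    (subst P (sym (+-suc fuel lo)) Phi)

-- Least cost of a walk from one vertex to another in a finite digraph with
-- ℕ-weighted edges, by the Floyd–Warshall recursion.
module LeastCost
  {X : Set} (_≟ˣ_ : DecidableEquality X)
  (vertices : List X) (complete : ∀ x → x ∈ˡ vertices)
  (Edge : X → X → ℕ → Set) (edge? : ∀ x y → Decidable (Edge x y))
  where

  data Walk : X → X → ℕ → Set where
    stop : ∀ {x} → Walk x x 0
    go   : ∀ {x y z a b} → Edge x y a → Walk y z b → Walk x z (a + b)

  _++ʷ_ : ∀ {x y z a b} → Walk x y a → Walk y z b → Walk x z (a + b)
  stop           ++ʷ w = w
  _++ʷ_ {b = c} (go {a = a} {b} e v) w = subst (Walk _ _) (sym (+-assoc a b c)) (go e (v ++ʷ w))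

  -- Cost at most s, with intermediate vertices from the list, each used once.
  Within : List X → X → X → Pred ℕ 0ℓ
  Within []       x y s = x ≡ y ⊎ (∃ λ a → a < suc s × Edge x y a)
  Within (z ∷ zs) x y s =
    Within zs x y s ⊎ (∃ λ a → a < suc s × Within zs x z a × Within zs z y (s ∸ a))

  within? : ∀ zs x y → Decidable (Within zs x y)
  within? []       x y s = (x ≟ˣ y) ⊎-dec anyUpTo? (edge? x y) (suc s)
  within? (z ∷ zs) x y s =
    within? zs x y s ⊎-dec
    anyUpTo? (λ a → within? zs x z a ×-dec within? zs z y (s ∸ a)) (suc s)

  mono : ∀ zs {x y s t} → s ≤ t → Within zs x y s → Within zs x y t
  mono []       s≤t (inj₁ x≡y)            = inj₁ x≡y
  mono []       s≤t (inj₂ (a , a<s , e))  = inj₂ (a , ≤-trans a<s (s≤s s≤t) , e)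
  mono (z ∷ zs) s≤t (inj₁ w)              = inj₁ (mono zs s≤t w)
  mono (z ∷ zs) s≤t (inj₂ (a , a<s , v , w)) =
    inj₂ (a , ≤-trans a<s (s≤s s≤t) , v , mono zs (∸-monoˡ-≤ a s≤t) w)

  via : ∀ zs {x y z a b s} → a + b ≤ s →
        Within zs x z a → Within zs z y b → Within (z ∷ zs) x y s
  via zs {a = a} {b} {s} a+b≤s v w =
    inj₂ (a , s≤s (m+n≤o⇒m≤o a a+b≤s) , v ,
          mono zs (m+n≤o⇒m≤o∸n b (subst (_≤ s) (+-comm a b) a+b≤s)) w)

  join : ∀ zs {x m y p q} → m ∈ˡ zs →
         Within zs x m p → Within zs m y q → Within zs x y (p + q)
  join (z ∷ zs) {x} {_} {y} {p} {q} (here refl) v w = via zs ≤-refl (before v) (after w)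
    where
    before : Within (z ∷ zs) x z p → Within zs x z p
    before (inj₁ v)                       = v
    before (inj₂ (a , s≤s a≤p , v , _))   = mono zs a≤p v
    after : Within (z ∷ zs) z y q → Within zs z y q
    after (inj₁ w)                = w
    after (inj₂ (a , _ , _ , w))  = mono zs (m∸n≤m q a) w
  join (z ∷ zs) (there m∈) (inj₁ v) (inj₁ w) = inj₁ (join zs m∈ v w)
  join (z ∷ zs) {p = p} {q} (there m∈) (inj₁ v) (inj₂ (a , s≤s a≤q , w , w′)) =
    via zs (≤-reflexive (trans (+-assoc p a (q ∸ a)) (cong (p +_) (m+[n∸m]≡n a≤q))))
      (join zs m∈ v w) w′
  join (z ∷ zs) {p = p} {q} (there m∈) (inj₂ (a , s≤s a≤p , v , v′)) (inj₁ w) =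
    via zs (≤-reflexive (trans (sym (+-assoc a (p ∸ a) q)) (cong (_+ q) (m+[n∸m]≡n a≤p))))
      v (join zs m∈ v′ w)
  join (z ∷ zs) {p = p} {q} (there m∈) (inj₂ (a , s≤s a≤p , v , _)) (inj₂ (b , _ , _ , w)) =
    via zs (+-mono-≤ a≤p (m∸n≤m q b)) v w

  base : ∀ zs {x y s} → Within [] x y s → Within zs x y s
  base []       w = w
  base (z ∷ zs) w = inj₁ (base zs w)

  walk⇒within : ∀ {x y s} → Walk x y s → Within vertices x y s
  walk⇒within stop = base vertices (inj₁ refl)
  walk⇒within (go {a = a} e w) =
    join vertices (complete _) (base vertices (inj₂ (a , ≤-refl , e))) (walk⇒within w)

  within⇒walk : ∀ zs {x y s} → Within zs x y s → ∃ λ t → t ≤ s × Walk x y t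
  within⇒walk []       (inj₁ refl)                = 0 , z≤n , stop
  within⇒walk []       (inj₂ (a , s≤s a≤s , e))   =
    a + 0 , subst (_≤ _) (sym (+-identityʳ a)) a≤s , go e stop
  within⇒walk (z ∷ zs) (inj₁ w)                   = within⇒walk zs w
  within⇒walk (z ∷ zs) (inj₂ (a , s≤s a≤s , v , w))
    with within⇒walk zs v | within⇒walk zs w
  ... | b , b≤a , v′ | c , c≤s∸a , w′ =
    b + c , subst (b + c ≤_) (m+[n∸m]≡n a≤s) (+-mono-≤ b≤a c≤s∸a) , v′ ++ʷ w′

  leastCost : ∀ {x y} → ∃ (Walk x y) → ∃ (IsLeast (Walk x y))
  leastCost {x} {y} (s , w)
    with least (within? vertices x y) (s , walk⇒within w)
  ... | m , v , m≤ with within⇒walk vertices v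
  ... | t , t≤m , u with ≤-antisym t≤m (m≤ (walk⇒within u))
  ... | refl = m , u , λ w′ → m≤ (walk⇒within w′)

subsets : ∀ n → List (Subset n)
subsets zero    = [] ∷ []
subsets (suc n) = map (inside ∷_) (subsets n) ++ map (outside ∷_) (subsets n)

∈-subsets : ∀ {n} (p : Subset n) → p ∈ˡ subsets n
∈-subsets []            = here refl
∈-subsets (inside  ∷ p) = ∈-++⁺ˡ (∈-map⁺ (inside ∷_) (∈-subsets p))
∈-subsets (outside ∷ p) = ∈-++⁺ʳ (map (inside ∷_) (subsets _)) (∈-map⁺ (outside ∷_) (∈-subsets p))

module _ {n : ℕ} (G : Graph n) (T : ThresholdAssignment G) where
  open ThresholdAssignment T

  Evolves : ∀ {k} → (S Q : Vector (Subset n) (suc k)) → Set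
  Evolves {k} S Q = ∀ (i : Fin k) v →
    v ∈ Q (suc i) ⇔ τ v ≤ ∣ neighbours G v ∩ (S (inject₁ i) ∪ Q (inject₁ i)) ∣

  IsTTS : ∀ {k} → Vector (Subset n) (suc k) → Set
  IsTTS {k} S = ∃ λ (Q : Vector (Subset n) (suc k)) →
    Q zero ≡ ⊥ × Evolves S Q × S (fromℕ k) ≡ ⊥ × Q (fromℕ k) ≡ ⊤

  size : ∀ {k} → Vector (Subset n) (suc k) → ℕ
  size S = sum (λ i → ∣ S i ∣)

  HasTTSOfSize : Pred ℕ 0ℓ
  HasTTSOfSize s = ∃₂ λ k (S : Vector (Subset n) (suc k)) → IsTTS S × size S ≡ s

  private
    next : Subset n → Subset n
    next A = comprehension (λ v → τ v ≤? ∣ neighbours G v ∩ A ∣)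

    Edge : Subset n → Subset n → ℕ → Set
    Edge q r a = ∃ λ S → ∣ S ∣ ≡ a × next (S ∪ q) ≡ r

    _≟ˢ_ : DecidableEquality (Subset n)
    _≟ˢ_ = ≡-dec _≟ᵇ_

    open LeastCost _≟ˢ_ (subsets n) ∈-subsets Edge
      (λ q r a → anySubset? (λ S → (∣ S ∣ ≟ a) ×-dec (next (S ∪ q) ≟ˢ r)))

    ∈-next : ∀ A v → v ∈ next A ⇔ τ v ≤ ∣ neighbours G v ∩ A ∣
    ∈-next A v = ∈-comprehension (λ v → τ v ≤? ∣ neighbours G v ∩ A ∣)

    toWalk : ∀ k (S Q : Vector (Subset n) (suc k)) →
             Evolves S Q → S (fromℕ k) ≡ ⊥ → Walk (Q zero) (Q (fromℕ k)) (size S)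
    toWalk zero S Q ev S-end =
      subst (Walk _ _) (sym (trans (+-identityʳ _) (trans (cong ∣_∣ S-end) (∣⊥∣≡0 n)))) stop
    toWalk (suc k) S Q ev S-end =
      go (S zero , refl , next≡) (toWalk k (S ∘ suc) (Q ∘ suc) (ev ∘ suc) S-end)
      where
      next≡ : next (S zero ∪ Q zero) ≡ Q (suc zero)
      next≡ = ⊆-antisym
        (λ {v} v∈ → Equivalence.from (ev zero v) (Equivalence.to (∈-next _ v) v∈))
        (λ {v} v∈ → Equivalence.from (∈-next _ v) (Equivalence.to (ev zero v) v∈))

    fromWalk : ∀ {q r s} → Walk q r s →
               ∃ λ k → ∃₂ λ (S Q : Vector (Subset n) (suc k)) →
               Q zero ≡ q × Evolves S Q × S (fromℕ k) ≡ ⊥ × Q (fromℕ k) ≡ r × size S ≡ s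
    fromWalk {q} stop =
      0 , (λ _ → ⊥) , (λ _ → q) , refl , (λ ()) , refl , refl , trans (+-identityʳ _) (∣⊥∣≡0 n)
    fromWalk {q} (go (A , refl , refl) w) with fromWalk w
    ... | k , S , Q , Q-start , ev , S-end , Q-end , refl =
      suc k , (A Vector.∷ S) , (q Vector.∷ Q) , refl , ev′ , S-end , Q-end , refl
      where
      ev′ : Evolves (A Vector.∷ S) (q Vector.∷ Q)
      ev′ zero    v rewrite Q-start = ∈-next (A ∪ q) v
      ev′ (suc i) v = ev i v

    Walk⇒TTS : ∀ {s} → Walk ⊥ ⊤ s → HasTTSOfSize s
    Walk⇒TTS w with fromWalk w
    ... | k , S , Q , Q-start , ev , S-end , Q-end , size≡ =
      k , S , (Q , Q-start , ev , S-end , Q-end) , size≡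

    TTS⇒Walk : ∀ {s} → HasTTSOfSize s → Walk ⊥ ⊤ s
    TTS⇒Walk (k , S , (Q , Q-start , ev , S-end , Q-end) , refl) =
      subst₂ (λ q r → Walk q r (size S)) Q-start Q-end (toWalk k S Q ev S-end)

    activateAll : Walk ⊥ ⊤ (∣ ⊤ {n} ∣ + 0)
    activateAll = go (⊤ , refl , ⊆-antisym (λ _ → ∈⊤) (λ {v} _ → Equivalence.from (∈-next _ v) (τ≤ v))) stop
      where
      τ≤ : ∀ v → τ v ≤ ∣ neighbours G v ∩ (⊤ ∪ ⊥) ∣
      τ≤ v rewrite ∪-identityʳ (⊤ {n}) | ∩-identityʳ (neighbours G v) = τ≤degree v

  abstract
    leastTTSSize : ∃ (IsLeast HasTTSOfSize)
    leastTTSSize with leastCost (_ , activateAll)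
    ... | m , w , m≤ = m , Walk⇒TTS w , λ h → m≤ (TTS⇒Walk h)

  MTT : ℕ
  MTT = proj₁ leastTTSSize

  MTT-isLeast : IsLeast HasTTSOfSize MTT
  MTT-isLeast = proj₂ leastTTSSize

{-# OPTIONS --safe #-}
-- Scale by 2, so that thresholds become 2τ(v) = d(v) + 2 ≤ Δ + 2. For consecutive active sets
-- P = S_{i-1} ∪ Q_{i-1} and A = S_i ∪ Q_i consider the Goles–Olivos energy
-- Σ_{v∈P} 2τ(v) + Σ_{v∈A} 2τ(v) − 2e(P, A), where e counts adjacent pairs. It is 0 for P = A = ∅.
-- As e is symmetric, replacing P by Q_{i+1} cannot increase it, because Q_{i+1} contains exactly
-- the nodes whose threshold is met by A; adding one seed raises it by at most Δ + 2. When
-- everything has become active it is at least 4n, whatever the other set is.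
module Submission where

open import Defs
open import Data.Bool using (Bool; true; false; _∧_; _∨_; if_then_else_)
open import Data.Fin using (Fin; zero; suc; fromℕ)
import Data.Fin.Properties as Fin
open import Data.Fin.Subset using (Subset; _∈_; _∩_; _∪_; ∣_∣; ⊥; ⊤)
open import Data.Fin.Subset.Properties using (∈⊤; ∩-identityʳ)
open import Data.Integer using (+_)
import Data.Integer as ℤ
import Data.Integer.Properties as ℤ
open import Data.Nat
  using (ℕ; zero; suc; _+_; _*_; _<_; _≤_; _⊔_; z≤n; s≤s; z<s; _≤?_; ⌈_/2⌉)
open import Data.Nat.Divisibility using (_∣_; divides)
open import Data.Nat.Properties
open import Data.Nat.Tactic.RingSolver using (solve-∀)
open import Data.Product using (Σ; ∃; ∃₂; _×_; _,_; proj₁; proj₂)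
open import Data.Rational using (_/_; _≥_)
import Data.Rational.Properties as ℚ
import Data.Rational.Unnormalised as ℚᵘ
import Data.Rational.Unnormalised.Properties as ℚᵘ
open import Data.Vec using (lookup; []; _∷_)
open import Data.Vec.Properties
  using ([]=⇒lookup; lookup⇒[]=; lookup-zipWith; lookup-replicate; lookup∘tabulate)
open import Data.Vec.Functional as Vector using (Vector)
open import Function.Base using (_∘_)
open import Function.Bundles using (_⇔_; mk⇔; Equivalence)
open import Relation.Binary.PropositionalEquality
open import Relation.Nullary using (¬?; does; contradiction)
open import Relation.Nullary.Decidable using (does-⇔; from-yes)

open import Algebra.Properties.Semiring.Sum +-*-semiring
  using (sum; sum-cong-≗; ∑-distrib-+; ∑-comm; *-distribˡ-sum)

-- Sums over nodes and indicator functions of subsets.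

sum-mono-≤ : ∀ {n} {f g : Vector ℕ n} → (∀ i → f i ≤ g i) → sum f ≤ sum g
sum-mono-≤ {zero}  f≤g = z≤n
sum-mono-≤ {suc n} f≤g = +-mono-≤ (f≤g zero) (sum-mono-≤ (f≤g ∘ suc))

sum-const : ∀ n c → sum {n} (λ _ → c) ≡ c * n
sum-const zero    c = sym (*-zeroʳ c)
sum-const (suc n) c = trans (cong (_+_ c) (sum-const n c)) (sym (*-suc c n))

≤-maximum : ∀ {n} (f : Vector ℕ n) i → f i ≤ Vector.foldr _⊔_ 0 f
≤-maximum f zero    = m≤m⊔n _ _
≤-maximum f (suc i) = ≤-trans (≤-maximum (f ∘ suc) i) (m≤n⊔m (f zero) _)

bit : Bool → ℕ
bit b = if b then 1 else 0

bit-∧ : ∀ a b → bit (a ∧ b) ≡ bit a * bit b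
bit-∧ true  b = sym (*-identityˡ (bit b))
bit-∧ false b = refl

χ : ∀ {n} → Subset n → Fin n → ℕ
χ X v = bit (lookup X v)

χ-⊥ : ∀ {n} (v : Fin n) → χ ⊥ v ≡ 0
χ-⊥ v = cong bit (lookup-replicate v false)

χ-⊤ : ∀ {n} (v : Fin n) → χ ⊤ v ≡ 1
χ-⊤ v = cong bit (lookup-replicate v true)

∣X∣≡sum-χ : ∀ {n} (X : Subset n) → ∣ X ∣ ≡ sum (χ X)
∣X∣≡sum-χ []          = refl
∣X∣≡sum-χ (true  ∷ X) = cong suc (∣X∣≡sum-χ X)
∣X∣≡sum-χ (false ∷ X) = ∣X∣≡sum-χ X

∣X∩Y∣≡sum : ∀ {n} (X Y : Subset n) → ∣ X ∩ Y ∣ ≡ sum (λ v → χ X v * χ Y v)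
∣X∩Y∣≡sum X Y = trans (∣X∣≡sum-χ (X ∩ Y)) (sum-cong-≗ λ v →
  trans (cong bit (lookup-zipWith _∧_ v X Y)) (bit-∧ (lookup X v) (lookup Y v)))

-- Weights of subsets, and how they change with the subset.

weight : ∀ {n} → (Fin n → ℕ) → Subset n → ℕ
weight f X = sum (λ v → χ X v * f v)

weight-⊥ : ∀ {n} (f : Fin n → ℕ) → weight f ⊥ ≡ 0
weight-⊥ {n} f = trans (sum-cong-≗ (λ v → cong (_* f v) (χ-⊥ v))) (sum-const n 0)

weight-+ : ∀ {n} (f g : Fin n → ℕ) X Y →
           sum (λ v → χ X v * f v + χ Y v * g v) ≡ weight f X + weight g Y
weight-+ f g X Y = ∑-distrib-+ (λ v → χ X v * f v) (λ v → χ Y v * g v)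

-- `Q` takes exactly the nodes at which `f v - g v` is not positive, so it minimises
-- `weight f X - weight g X` over all subsets `X`. Moving the negative terms across keeps this in
-- the naturals.
weight-superlevel : ∀ {n} (f g : Fin n → ℕ) {Q} → (∀ v → v ∈ Q ⇔ f v ≤ g v) → ∀ P →
                    weight f Q + weight g P ≤ weight f P + weight g Q
weight-superlevel f g {Q} Q⇔ P =
  subst₂ _≤_ (weight-+ f g Q P) (weight-+ f g P Q) (sum-mono-≤ pointwise)
  where
  pointwise : ∀ v → χ Q v * f v + χ P v * g v ≤ χ P v * f v + χ Q v * g v
  pointwise v with lookup Q v in Qv | lookup P v
  ... | true  | true  = ≤-refl
  ... | false | false = ≤-refl
  -- The first rewrite clears `1 * f v`, the second the zero left by the other product.
  ... | true  | false
    rewrite +-identityʳ (f v) | +-identityʳ (f v) | +-identityʳ (g v) =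
    Equivalence.to (Q⇔ v) (lookup⇒[]= v Q Qv)
  ... | false | true
    rewrite +-identityʳ (f v) | +-identityʳ (f v) | +-identityʳ (g v) =
    ≰⇒≥ λ f≤g → contradiction (trans (sym Qv) ([]=⇒lookup (Equivalence.from (Q⇔ v) f≤g))) λ ()

-- Only nodes of `S` outside `Q` are new, and each raises `weight f - weight g` by `f v - g v`,
-- hence by at most `c`.
weight-∪ : ∀ {n} (f g : Fin n → ℕ) {c} → (∀ v → f v ≤ c) → ∀ S Q →
           weight f (S ∪ Q) + weight g Q ≤ weight f Q + weight g (S ∪ Q) + c * ∣ S ∣
weight-∪ {n} f g {c} f≤c S Q =
  subst₂ _≤_ (weight-+ f g (S ∪ Q) Q) (begin-equality
    sum (λ v → χ Q v * f v + χ (S ∪ Q) v * g v + c * χ S v)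
      ≡⟨ ∑-distrib-+ (λ v → χ Q v * f v + χ (S ∪ Q) v * g v) (λ v → c * χ S v) ⟩
    sum (λ v → χ Q v * f v + χ (S ∪ Q) v * g v) + sum (λ v → c * χ S v)
      ≡⟨ cong₂ _+_ (weight-+ f g Q (S ∪ Q))
           (trans (sym (*-distribˡ-sum c (χ S))) (cong (c *_) (sym (∣X∣≡sum-χ S)))) ⟩
    weight f Q + weight g (S ∪ Q) + c * ∣ S ∣ ∎)
  (sum-mono-≤ pointwise)
  where
  open ≤-Reasoning
  pointwise : ∀ v → χ (S ∪ Q) v * f v + χ Q v * g v
                  ≤ χ Q v * f v + χ (S ∪ Q) v * g v + c * χ S v
  pointwise v rewrite lookup-zipWith _∨_ v S Q with lookup S v | lookup Q v
  ... | true  | true  = m≤m+n _ _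
  ... | false | q     = m≤m+n _ _
  ... | true  | false
    rewrite +-identityʳ (f v) | +-identityʳ (f v) | *-identityʳ c =
    ≤-trans (f≤c v) (m≤n+m c _)

-- Symmetry of the edge count between two subsets.

module _ {n} (G : Graph n) where
  open Graph G

  χ-neighbours-sym : ∀ u v → χ (neighbours G u) v ≡ χ (neighbours G v) u
  χ-neighbours-sym u v = cong bit (trans (lookup-neighbours u v)
    (trans (does-⇔ (mk⇔ adj-sym adj-sym) (adj? u v) (adj? v u)) (sym (lookup-neighbours v u))))
    where
    lookup-neighbours : ∀ u v → lookup (neighbours G u) v ≡ does (adj? u v)
    lookup-neighbours u v = lookup∘tabulate (does ∘ adj? u) v

  -- This is the term 2e(X, Y) of the energy. Written as a weight of `X`, it can serve as `weight g`
  -- in the comparisons above with `Y` fixed.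
  edges : Subset n → Subset n → ℕ
  edges X Y = weight (λ v → 2 * ∣ neighbours G v ∩ Y ∣) X

  edges≡∑∑ : ∀ X Y → edges X Y ≡ sum (λ v → sum (λ u → χ X v * (2 * (χ (neighbours G v) u * χ Y u))))
  edges≡∑∑ X Y = sum-cong-≗ λ v → begin
    χ X v * (2 * ∣ neighbours G v ∩ Y ∣)
      ≡⟨ cong (λ x → χ X v * (2 * x)) (∣X∩Y∣≡sum (neighbours G v) Y) ⟩
    χ X v * (2 * sum (λ u → χ (neighbours G v) u * χ Y u))
      ≡⟨ cong (χ X v *_) (*-distribˡ-sum 2 (λ u → χ (neighbours G v) u * χ Y u)) ⟩
    χ X v * sum (λ u → 2 * (χ (neighbours G v) u * χ Y u))
      ≡⟨ *-distribˡ-sum (χ X v) (λ u → 2 * (χ (neighbours G v) u * χ Y u)) ⟩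
    sum (λ u → χ X v * (2 * (χ (neighbours G v) u * χ Y u))) ∎
    where open ≡-Reasoning

  -- Double counting: expand into a sum over pairs of nodes, exchange the order of summation, and
  -- use the symmetry of adjacency.
  edges-sym : ∀ X Y → edges X Y ≡ edges Y X
  edges-sym X Y = begin
    edges X Y
      ≡⟨ edges≡∑∑ X Y ⟩
    sum (λ v → sum (λ u → χ X v * (2 * (χ (neighbours G v) u * χ Y u))))
      ≡⟨ ∑-comm (λ v u → χ X v * (2 * (χ (neighbours G v) u * χ Y u))) ⟩
    sum (λ u → sum (λ v → χ X v * (2 * (χ (neighbours G v) u * χ Y u))))
      ≡⟨ sum-cong-≗ (λ u → sum-cong-≗ λ v → trans
           (cong (λ x → χ X v * (2 * (x * χ Y u))) (χ-neighbours-sym v u))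
           (swap (χ X v) (χ (neighbours G u) v) (χ Y u))) ⟩
    sum (λ u → sum (λ v → χ Y u * (2 * (χ (neighbours G u) v * χ X v))))
      ≡⟨ edges≡∑∑ Y X ⟨
    edges Y X ∎
    where
    open ≡-Reasoning
    swap : ∀ x a y → x * (2 * (a * y)) ≡ y * (2 * (a * x))
    swap = solve-∀

  -- The energy along the evolution.

  module _ (T : ThresholdAssignment G) where
    open ThresholdAssignment T

    θ : Fin n → ℕ
    θ v = 2 * τ v

    -- The energy of (X, Y) is at most e, with both sides moved to avoid subtraction.
    Energy≤ : Subset n → Subset n → ℕ → Set
    Energy≤ X Y e = weight θ X + weight θ Y ≤ edges X Y + e

    -- With `A` fixed, the part of the energy depending on the other set X is
    -- `weight θ X - edges X A`, and `Q` minimises it by `weight-superlevel`. Symmetry of `edges`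
    -- then lets `A` take the place of the older set.
    energy-update : ∀ {P A Q e} → (∀ v → v ∈ Q ⇔ τ v ≤ ∣ neighbours G v ∩ A ∣) →
                    Energy≤ P A e → Energy≤ A Q e
    energy-update {P} {A} {Q} {e} Q⇔ energy≤ = +-cancelʳ-≤ (edges P A) _ _ (begin
      weight θ A + weight θ Q + edges P A
        ≡⟨ +-assoc (weight θ A) _ _ ⟩
      weight θ A + (weight θ Q + edges P A)
        ≤⟨ +-monoʳ-≤ (weight θ A) (weight-superlevel θ (λ v → 2 * ∣ neighbours G v ∩ A ∣) Q⇔θ P) ⟩
      weight θ A + (weight θ P + edges Q A)
        ≡⟨ regroup₁ (weight θ A) (weight θ P) (edges Q A) ⟩
      weight θ P + weight θ A + edges Q A
        ≤⟨ +-mono-≤ energy≤ (≤-reflexive (edges-sym Q A)) ⟩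
      edges P A + e + edges A Q
        ≡⟨ regroup₂ (edges P A) e (edges A Q) ⟩
      edges A Q + e + edges P A ∎)
      where
      open ≤-Reasoning
      regroup₁ : ∀ a p x → a + (p + x) ≡ p + a + x
      regroup₁ = solve-∀
      regroup₂ : ∀ p e q → p + e + q ≡ q + e + p
      regroup₂ = solve-∀
      Q⇔θ : ∀ v → v ∈ Q ⇔ θ v ≤ 2 * ∣ neighbours G v ∩ A ∣
      Q⇔θ v = mk⇔ (*-monoʳ-≤ 2 ∘ Equivalence.to (Q⇔ v))
                  (Equivalence.from (Q⇔ v) ∘ *-cancelˡ-≤ 2)

    module _ {c} (θ≤c : ∀ v → θ v ≤ c) where

      -- Each new seed costs at most `θ v ≤ c`, and its edges to `P` can only lower the energy.
      energy-seed : ∀ {P Q s} S → Energy≤ P Q (c * s) → Energy≤ P (S ∪ Q) (c * (∣ S ∣ + s))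
      energy-seed {P} {Q} {s} S energy≤ = +-cancelʳ-≤ (edges Q P) _ _ (begin
        weight θ P + weight θ (S ∪ Q) + edges Q P
          ≡⟨ +-assoc (weight θ P) _ _ ⟩
        weight θ P + (weight θ (S ∪ Q) + edges Q P)
          ≤⟨ +-monoʳ-≤ (weight θ P) (weight-∪ θ (λ v → 2 * ∣ neighbours G v ∩ P ∣) θ≤c S Q) ⟩
        weight θ P + (weight θ Q + edges (S ∪ Q) P + c * ∣ S ∣)
          ≡⟨ regroup₁ (weight θ P) (weight θ Q) (edges (S ∪ Q) P) (c * ∣ S ∣) ⟩
        weight θ P + weight θ Q + (edges (S ∪ Q) P + c * ∣ S ∣)
          ≤⟨ +-monoˡ-≤ _ energy≤ ⟩
        edges P Q + c * s + (edges (S ∪ Q) P + c * ∣ S ∣)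
          -- `weight-∪` enlarges the first argument of `edges`, while the seeds join the second set
          -- of the energy; symmetry converts both terms.
          ≡⟨ cong₂ (λ x y → x + c * s + (y + c * ∣ S ∣)) (edges-sym P Q) (edges-sym (S ∪ Q) P) ⟩
        edges Q P + c * s + (edges P (S ∪ Q) + c * ∣ S ∣)
          ≡⟨ regroup₂ (edges Q P) c s (edges P (S ∪ Q)) ∣ S ∣ ⟩
        edges P (S ∪ Q) + c * (∣ S ∣ + s) + edges Q P ∎)
        where
        open ≤-Reasoning
        regroup₁ : ∀ p q x y → p + (q + x + y) ≡ p + q + (x + y)
        regroup₁ = solve-∀
        regroup₂ : ∀ q c s p t → q + c * s + (p + c * t) ≡ p + c * (t + s) + q
        regroup₂ = solve-∀

      -- Induction on the number of rounds, each a seeding followed by an update. `s` counts the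
      -- seeds already spent, and `P` is the active set of the previous round. Its final value is
      -- left existential, as the closing estimate holds for every such set.
      energy-end : ∀ k (S Q : Vector (Subset n) (suc k)) → Evolves G T S Q →
                   ∀ {P s} → Energy≤ P (Q zero) (c * s) →
                   ∃ λ P′ → Energy≤ P′ (Q (fromℕ k)) (c * (size G T S + s))
      -- `size` also counts the last seed set, which can only enlarge the bound.
      energy-end zero    S Q ev {P} {s} energy≤ =
        P , ≤-trans energy≤ (+-monoʳ-≤ (edges P (Q zero)) (*-monoʳ-≤ c (m≤n+m s (size G T S))))
      energy-end (suc k) S Q ev {P} {s} energy≤
        with energy-end k (S ∘ suc) (Q ∘ suc) (ev ∘ suc) {S zero ∪ Q zero}
               (energy-update {P} {S zero ∪ Q zero} {Q (suc zero)} (ev zero)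
                 (energy-seed {P} {Q zero} {s} (S zero) energy≤))
      ... | P′ , energy′≤ =
        P′ , subst (λ x → Energy≤ P′ (Q (fromℕ (suc k))) (c * x))
               (regroup (size G T (S ∘ suc)) ∣ S zero ∣ s) energy′≤
        where
        regroup : ∀ x y z → x + (y + z) ≡ y + x + z
        regroup = solve-∀

      energy-TTS : ∀ {k} (S : Vector (Subset n) (suc k)) → IsTTS G T S →
                   ∃ λ P → Energy≤ P ⊤ (c * size G T S)
      energy-TTS {k} S (Q , Q₀≡⊥ , ev , _ , Qₖ≡⊤)
        with energy-end k S Q ev {⊥} {0} start
        where
        -- The empty set stands in for the active set before time 0, so the energy starts at 0.
        start : Energy≤ ⊥ (Q zero) (c * 0)
        start rewrite Q₀≡⊥ | weight-⊥ θ = z≤n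
      ... | P , energy≤ =
        P , subst₂ (λ X x → Energy≤ P X (c * x)) Qₖ≡⊤ (+-identityʳ (size G T S)) energy≤

-- The lower bound for strict majority with even degrees.

-- For even `d` the number `d + 1` is odd, so rounding up gains one half and doubling yields
-- `d + 2`.
2*⌈d+1/2⌉ : ∀ {d} → 2 ∣ d → 2 * ⌈ d + 1 /2⌉ ≡ 2 + d
2*⌈d+1/2⌉ (divides q refl) = begin
  2 * ⌈ q * 2 + 1 /2⌉   ≡⟨ cong (λ x → 2 * ⌈ x /2⌉) (+-comm (q * 2) 1) ⟩
  2 * ⌈ 1 + q * 2 /2⌉   ≡⟨ cong (2 *_) (⌈1+q*2/2⌉ q) ⟩
  2 * suc q             ≡⟨ regroup q ⟩
  2 + q * 2             ∎
  where
  open ≡-Reasoning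
  ⌈1+q*2/2⌉ : ∀ q → ⌈ 1 + q * 2 /2⌉ ≡ suc q
  ⌈1+q*2/2⌉ zero    = refl
  ⌈1+q*2/2⌉ (suc q) = cong suc (⌈1+q*2/2⌉ q)
  regroup : ∀ q → 2 * suc q ≡ 2 + q * 2
  regroup = solve-∀

even-positive⇒≥2 : ∀ {d} → 0 < d → 2 ∣ d → 2 ≤ d
even-positive⇒≥2 () (divides zero refl)
even-positive⇒≥2 _  (divides (suc q) refl) = s≤s (s≤s z≤n)

module _ {n} (G : Graph n) (noIsolated : NoIsolatedNodes G) (even : EvenDegrees G) where

  private
    T = strictMajority G noIsolated

    θ≡ : ∀ v → θ G T v ≡ 2 + degree G v
    θ≡ v = 2*⌈d+1/2⌉ (even v)

    θ≤2+maxDegree : ∀ v → θ G T v ≤ 2 + maxDegree G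
    θ≤2+maxDegree v = subst (_≤ 2 + maxDegree G) (sym (θ≡ v)) (+-monoʳ-≤ 2 (≤-maximum (degree G) v))

  -- The energy of `P` and `⊤` splits into one contribution per node, and each is at least 4.
  energy-⊤ : ∀ {P e} → Energy≤ G T P ⊤ e → 4 * n ≤ e
  energy-⊤ {P} {e} energy≤ = +-cancelʳ-≤ (edges G P ⊤) _ _ (begin
    4 * n + edges G P ⊤
      ≡⟨ cong (_+ edges G P ⊤) (sum-const n 4) ⟨
    sum {n} (λ _ → 4) + edges G P ⊤
      ≡⟨ ∑-distrib-+ {n} (λ _ → 4) (λ v → χ P v * (2 * ∣ neighbours G v ∩ ⊤ ∣)) ⟨
    sum (λ v → 4 + χ P v * (2 * ∣ neighbours G v ∩ ⊤ ∣))
      ≤⟨ sum-mono-≤ pointwise ⟩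
    sum (λ v → χ P v * θ G T v + χ ⊤ v * θ G T v)
      ≡⟨ weight-+ (θ G T) (θ G T) P ⊤ ⟩
    weight (θ G T) P + weight (θ G T) ⊤
      ≤⟨ energy≤ ⟩
    edges G P ⊤ + e
      ≡⟨ +-comm _ e ⟩
    e + edges G P ⊤ ∎)
    where
    open ≤-Reasoning
    double : ∀ d → 4 + 1 * (2 * d) ≡ 1 * (2 + d) + 1 * (2 + d)
    double = solve-∀
    pointwise : ∀ v → 4 + χ P v * (2 * ∣ neighbours G v ∩ ⊤ ∣)
                    ≤ χ P v * θ G T v + χ ⊤ v * θ G T v
    pointwise v rewrite ∩-identityʳ (neighbours G v) | χ-⊤ v | θ≡ v with lookup P v
    -- In `P`, a node of degree d contributes 2(d + 2) - 2d = 4. Outside `P` it contributes d + 2,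
    -- which is at least 4 because a positive even degree is at least 2.
    ... | true  = ≤-reflexive (double (degree G v))
    ... | false = ≤-trans (+-monoʳ-≤ 2 (even-positive⇒≥2 (noIsolated v) (even v)))
                          (≤-reflexive (sym (*-identityˡ (2 + degree G v))))

  4n≤[2+Δ]*MTT : 4 * n ≤ (2 + maxDegree G) * MTT G T
  4n≤[2+Δ]*MTT with proj₁ (MTT-isLeast G T)
  -- The cost per seed is `c = 2 + maxDegree G`, since `θ v = 2 + degree G v`.
  ... | k , S , tts , size≡MTT with energy-TTS G T {2 + maxDegree G} θ≤2+maxDegree S tts
  ... | P , energy≤ = subst (λ x → 4 * n ≤ (2 + maxDegree G) * x) size≡MTT (energy-⊤ {P} energy≤)

-- Tightness: the triangle.

triangle : Graph 3
triangle = record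
  { Adj        = _≢_
  ; adj?       = λ u v → ¬? (u Fin.≟ v)
  ; adj-sym    = ≢-sym
  ; adj-irrefl = λ u≡v u≢v → u≢v u≡v
  }

triangle-noIsolated : NoIsolatedNodes triangle
triangle-noIsolated = from-yes (Fin.all? λ v → 1 ≤? degree triangle v)

triangle-even : EvenDegrees triangle
triangle-even zero             = divides 1 refl
triangle-even (suc zero)       = divides 1 refl
triangle-even (suc (suc zero)) = divides 1 refl

-- Every threshold is 2, so seeding all three nodes at time 0 makes each node see two active
-- neighbours and become active at time 1.
triangle-TTS : HasTTSOfSize triangle (strictMajority triangle triangle-noIsolated) 3
triangle-TTS = 1 , (⊤ Vector.∷ ⊥ Vector.∷ Vector.[]) ,
  ((⊥ Vector.∷ ⊤ Vector.∷ Vector.[]) , refl , evolves , refl , refl) , refl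
  where
  τ-met : ∀ v → ⌈ degree triangle v + 1 /2⌉ ≤ ∣ neighbours triangle v ∩ (⊤ ∪ ⊥) ∣
  τ-met = from-yes (Fin.all? λ v →
    ⌈ degree triangle v + 1 /2⌉ ≤? ∣ neighbours triangle v ∩ (⊤ ∪ ⊥) ∣)
  evolves : Evolves triangle (strictMajority triangle triangle-noIsolated)
              (⊤ Vector.∷ ⊥ Vector.∷ Vector.[]) (⊥ Vector.∷ ⊤ Vector.∷ Vector.[])
  evolves zero v = mk⇔ (λ _ → τ-met v) (λ _ → ∈⊤)

MTT-triangle : MTT triangle (strictMajority triangle triangle-noIsolated) ≡ 3
MTT-triangle = ≤-antisym
  (proj₂ (MTT-isLeast triangle (strictMajority triangle triangle-noIsolated)) triangle-TTS)
  -- Here `2 + maxDegree triangle` computes to 4, so the bound reads 4 * 3 ≤ 4 * `MTT`.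
  (*-cancelˡ-≤ 4 (4n≤[2+Δ]*MTT triangle triangle-noIsolated triangle-even))

-- Passage to rational numbers.

-- `_/_` reduces to lowest terms, which hides the given numerator and denominator. Among
-- unnormalised fractions the order is cross multiplication, which is the hypothesis.
m/d≤k/1 : ∀ {m k d} → m ≤ suc d * k → + k / 1 ≥ + m / suc d
m/d≤k/1 {m} {k} {d} m≤ = ℚ.toℚᵘ-cancel-≤ (begin
  _                        ≃⟨ ℚ.toℚᵘ-fromℚᵘ (ℚᵘ.mkℚᵘ (+ m) d) ⟩
  ℚᵘ.mkℚᵘ (+ m) d          ≤⟨ ℚᵘ.*≤* (subst₂ ℤ._≤_ (ℤ.pos-* m 1) (ℤ.pos-* k (suc d))
                                 (ℤ.+≤+ (subst₂ _≤_ (sym (*-identityʳ m)) (*-comm (suc d) k) m≤))) ⟩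
  ℚᵘ.mkℚᵘ (+ k) 0          ≃⟨ ℚ.toℚᵘ-fromℚᵘ (ℚᵘ.mkℚᵘ (+ k) 0) ⟨
  _                        ∎)
  where open ℚᵘ.≤-Reasoning

theorem5 : (∀ {n : ℕ} (G : Graph n) (noIsolated : NoIsolatedNodes G) → EvenDegrees G →
    + MTT G (strictMajority G noIsolated) / 1 ≥ + (4 * n) / (2 + maxDegree G))
    ×
    (∃₂ λ (n : ℕ) (G : Graph n) → Σ (NoIsolatedNodes G) λ noIsolated →
    0 < n × EvenDegrees G ×
    + MTT G (strictMajority G noIsolated) / 1 ≡ + (4 * n) / (2 + maxDegree G))
theorem5 =
  (λ G noIsolated even → m/d≤k/1 {k = MTT G (strictMajority G noIsolated)}
    (4n≤[2+Δ]*MTT G noIsolated even)) ,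
  -- The right-hand side 12/4 normalises to 3/1 by computation.
  3 , triangle , triangle-noIsolated , z<s , triangle-even , cong (λ m → + m / 1) MTT-triangle
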